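{- For every formula $A$ of $\mathbf{L_1}$: $\dashv_H A$ if and only if $\dashv_T A$.
   Context: Formulas of $\mathbf{L_1}$: built from atomic formulas $\epsilon ab$ ($a,b$ name variables, possibly equal) with primitive connectives $\vee,\sim$; $\wedge,\supset,\equiv$ defined as usual. Disjunctions may be associated in any way. $\vdash_H A$: $A$ belongs to the smallest set containing all instances of classical propositional tautologies and all formulas $\epsilon ab\supset\epsilon aa$, $(\epsilon ab\wedge\epsilon bc)\supset\epsilon ac$, $(\epsilon ab\wedge\epsilon bb)\supset\epsilon ba$, closed under modus ponens. Positive/negative parts (occurrences): $A$ is a positive part of $A$; if $B\vee C$ is a positive part then $B,C$ are positive parts; if $\sim B$ is a positive part then $B$ is a negative part; if $\sim B$ is a negative part then $B$ is a positive part. $F[B_+]$ ($G[B_-]$) denotes a formula with a specified occurrence of $B$ as positive (negative) part; $F[B_+,C_-]$ etc. denote specified non-overlapping occurrences. Tableaux: reduction rules ($\vee_-$) $G[B\vee C_-]$ $\mapsto$ two branches $G[B\vee C_-]\vee\sim B$, $G[B\vee C_-]\vee\sim C$; ($\epsilon_1$) $G[\epsilon ab_-]\mapsto G[\epsilon ab_-]\vee\sim\epsilon aa$; ($\epsilon_2$) $G[\epsilon ab_-,\epsilon bc_-]\mapsto G[\epsilon ab_-,\epsilon bc_-]\vee\sim\epsilon ac$; ($\epsilon_{3b}$) $G[\epsilon ab_-,\epsilon bb_-]\mapsto G[\epsilon ab_-,\epsilon bb_-]\vee\sim\epsilon ba$. A tableau for $A$ is a finite tree with root $A$ whose non-leaf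 nodes have as children the result of applying one rule. Hintikka formula: a formula $H$ such that (1) $H$ is not of the form $F[B_+,B_-]$; (2) if $B\vee C$ is a negative part of $H$ then $B$ or $C$ is; (3) if $\epsilon ab$ is a negative part then so is $\epsilon aa$; (4) if $\epsilon ab,\epsilon bc$ are negative parts then so is $\epsilon ac$; (5) if $\epsilon ab,\epsilon bb$ are negative parts then so is $\epsilon ba$. $\mathbf{HAR}$: fix a name variable $a_0$; $\dashv_H$ is the smallest set such that $\dashv_H\epsilon a_0a_0$; $\dashv_H\sim\epsilon a_0a_0$; if $\vdash_H A\supset B$ and $\dashv_H B$ then $\dashv_H A$; if $\dashv_H A$ and $A$ is obtained from $B$ by uniform substitution of name variables for name variables then $\dashv_H B$; if $A$ is a Hintikka formula that is a disjunction of atomic or negated atomic formulas, $\dashv_H A$, and $\epsilon ab$ is not a negative part of $A$, then $\dashv_H A\vee\epsilon ab$. Gentzen-type axiomatic rejection $\mathbf{GAR}$: $\dashv_T A$ means that there exists a tableau for $A$ at least one branch of which ends with a Hintikka formula. -}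

module Defs where

open import Data.Bool.Base using (Bool; true; not) renaming (_∨_ to _or_)
open import Data.List.Base using (List; []; _∷_)
open import Data.List.Membership.Propositional using (_∈_)
open import Data.List.Relation.Unary.All as All using (All)
open import Data.Nat.Base using (ℕ)
open import Data.Product.Base using (_×_; _,_; ∃-syntax; Σ-syntax)
open import Data.Sum.Base using (_⊎_)
open import Relation.Binary.PropositionalEquality.Core using (_≡_)
open import Relation.Nullary.Negation.Core using (¬_)

infix  9 ∼_
infixr 7 _∧_
infixr 6 _∨_
infixr 5 _⊃_

-- Formulas over a set X of atoms: used both for L₁ and for the propositional
-- schemata whose substitution instances are axioms of ⊢H.
data Form (X : Set) : Set where
  atom : X → Form X
  _∨_  : Form X → Form X → Form X
  ∼_   : Form X → Form X

_∧_ _⊃_ : {X : Set} → Form X → Form X → Form X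
A ∧ B = ∼ (∼ A ∨ ∼ B)
A ⊃ B = ∼ A ∨ B

_⟦_⟧ : {X Y : Set} → Form X → (X → Form Y) → Form Y
atom x  ⟦ σ ⟧ = σ x
(A ∨ B) ⟦ σ ⟧ = (A ⟦ σ ⟧) ∨ (B ⟦ σ ⟧)
(∼ A)   ⟦ σ ⟧ = ∼ (A ⟦ σ ⟧)

eval : {X : Set} → (X → Bool) → Form X → Bool
eval v (atom x) = v x
eval v (A ∨ B)  = eval v A or eval v B
eval v (∼ A)    = not (eval v A)

Tautology : Form ℕ → Set
Tautology P = ∀ v → eval v P ≡ true

Name : Set
Name = ℕ

Formula : Set
Formula = Form (Name × Name)

pattern ε a b = atom (a , b)

rename : (Name → Name) → Formula → Formula
rename f A = A ⟦ (λ (a , b) → ε (f a) (f b)) ⟧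

infix 3 ⊢H_

data ⊢H_ : Formula → Set where
  taut : (P : Form ℕ) (σ : ℕ → Formula) → Tautology P → ⊢H P ⟦ σ ⟧
  ax₁  : ∀ a b → ⊢H ε a b ⊃ ε a a
  ax₂  : ∀ a b c → ⊢H (ε a b ∧ ε b c) ⊃ ε a c
  ax₃  : ∀ a b → ⊢H (ε a b ∧ ε b b) ⊃ ε b a
  mp   : ∀ {A B} → ⊢H A ⊃ B → ⊢H A → ⊢H B

data Sign : Set where
  pos neg : Sign

-- An element of Part s B A is an occurrence of B as an s-signed part of A,
-- recorded as the path leading to it from the root.
data Part : Sign → Formula → Formula → Set where
  root : ∀ {A} → Part pos A A
  ∨ˡ   : ∀ {A B C} → Part pos (B ∨ C) A → Part pos B A
  ∨ʳ   : ∀ {A B C} → Part pos (B ∨ C) A → Part pos C A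
  ∼⁺   : ∀ {A B} → Part pos (∼ B) A → Part neg B A
  ∼⁻   : ∀ {A B} → Part neg (∼ B) A → Part pos B A

-- p ⊑ q: the occurrence q lies inside (or is) the occurrence p.
data _⊑_ {A : Formula} {s : Sign} {B : Formula} (p : Part s B A) :
         {t : Sign} {C : Formula} → Part t C A → Set where
  here : p ⊑ p
  ∨ˡ   : ∀ {C D} {q : Part pos (C ∨ D) A} → p ⊑ q → p ⊑ ∨ˡ q
  ∨ʳ   : ∀ {C D} {q : Part pos (C ∨ D) A} → p ⊑ q → p ⊑ ∨ʳ q
  ∼⁺   : ∀ {C} {q : Part pos (∼ C) A} → p ⊑ q → p ⊑ ∼⁺ q
  ∼⁻   : ∀ {C} {q : Part neg (∼ C) A} → p ⊑ q → p ⊑ ∼⁻ q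

NonOverlapping : ∀ {A s B t C} → Part s B A → Part t C A → Set
NonOverlapping p q = ¬ (p ⊑ q) × ¬ (q ⊑ p)

infix 3 _↦_

data _↦_ (G : Formula) : List Formula → Set where
  ∨₋  : ∀ {B C} → Part neg (B ∨ C) G →
        G ↦ (G ∨ ∼ B) ∷ (G ∨ ∼ C) ∷ []
  ε₁  : ∀ {a b} → Part neg (ε a b) G →
        G ↦ (G ∨ ∼ ε a a) ∷ []
  ε₂  : ∀ {a b c} (p : Part neg (ε a b) G) (q : Part neg (ε b c) G) →
        NonOverlapping p q →
        G ↦ (G ∨ ∼ ε a c) ∷ []
  ε₃b : ∀ {a b} (p : Part neg (ε a b) G) (q : Part neg (ε b b) G) →
        NonOverlapping p q →
        G ↦ (G ∨ ∼ ε b a) ∷ []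

data Tableau (A : Formula) : Set where
  leaf : Tableau A
  node : ∀ {Bs} → A ↦ Bs → All Tableau Bs → Tableau A

-- BranchTo t L: a branch of t, from the root to a leaf labelled L.
data BranchTo : {A : Formula} → Tableau A → Formula → Set where
  stop : ∀ {A} → BranchTo {A} leaf A
  down : ∀ {A B Bs L} {r : A ↦ Bs} {ts : All Tableau Bs} (i : B ∈ Bs) →
         BranchTo (All.lookup ts i) L → BranchTo (node r ts) L

record Hintikka (H : Formula) : Set where
  field
    consistent : ¬ (∃[ B ] Σ[ p ∈ Part pos B H ] Σ[ q ∈ Part neg B H ] NonOverlapping p q)
    ∨-closed   : ∀ {B C} → Part neg (B ∨ C) H → Part neg B H ⊎ Part neg C H
    ε₁-closed  : ∀ {a b} → Part neg (ε a b) H → Part neg (ε a a) H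
    ε₂-closed  : ∀ {a b c} → Part neg (ε a b) H → Part neg (ε b c) H → Part neg (ε a c) H
    ε₃-closed  : ∀ {a b} → Part neg (ε a b) H → Part neg (ε b b) H → Part neg (ε b a) H

-- Disjunctions of one or more literals, associated in any way.
data LiteralDisjunction : Formula → Set where
  atom  : ∀ {a b} → LiteralDisjunction (ε a b)
  ∼atom : ∀ {a b} → LiteralDisjunction (∼ ε a b)
  _∨_   : ∀ {A B} → LiteralDisjunction A → LiteralDisjunction B → LiteralDisjunction (A ∨ B)

infix 3 _⊣H_ ⊣T_

-- a₀ ⊣H A: rejection in HAR with fixed name variable a₀.
data _⊣H_ (a₀ : Name) : Formula → Set where
  rej-atom  : a₀ ⊣H ε a₀ a₀
  rej-∼atom : a₀ ⊣H ∼ ε a₀ a₀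
  rej-mp    : ∀ {A B} → ⊢H A ⊃ B → a₀ ⊣H B → a₀ ⊣H A
  rej-subst : ∀ (f : Name → Name) {B} → a₀ ⊣H rename f B → a₀ ⊣H B
  rej-∨     : ∀ {A a b} → Hintikka A → LiteralDisjunction A → a₀ ⊣H A →
              ¬ Part neg (ε a b) A → a₀ ⊣H A ∨ ε a b

⊣T_ : Formula → Set
⊣T A = Σ[ t ∈ Tableau A ] ∃[ H ] BranchTo t H × Hintikka H

{-# OPTIONS --safe #-}
module Submission where

-- A formula is rejected in either calculus iff it has a countermodel: a Boolean
-- valuation of the atoms that satisfies the three ε-axioms and falsifies it.
-- HAR-rejection yields a countermodel by induction. A countermodel selects, at each
-- rule application, a branch all of whose nodes it falsifies; only finitely many
-- formulas can be added as negative parts, so the branch reaches a Hintikka formula.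
-- Conversely, a Hintikka formula H propositionally implies the disjunction of the
-- negations of its negative atoms and of its positive atoms. The negated atoms are
-- rejected by identifying all names with a₀, the positive ones are then added one at
-- a time by the last rule of HAR, so H, and every root of a branch ending in H, is
-- rejected.

open import Data.Bool.Base using (Bool; true; false; not; if_then_else_) renaming (_∨_ to _or_)
open import Data.Bool.Properties using (∨-conicalˡ; ∨-conicalʳ; ∨-idem; ∨-zeroʳ; not-injective; ¬-not)
open import Data.Empty using (⊥)
open import Data.List.Base using (List; []; _∷_; _++_; length; cartesianProductWith; foldl)
open import Data.List.Membership.Propositional using (_∈_; find)
open import Data.List.Membership.Propositional.Properties using (∈-++⁺ˡ; ∈-++⁺ʳ; ∈-++⁻; ∈-∃++; ∈-cartesianProductWith⁺; ∈-cartesianProductWith⁻)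
open import Data.List.Properties using (length-++-sucʳ)
open import Data.List.Relation.Binary.Subset.Propositional using (_⊆_)
open import Data.List.Relation.Unary.All as All using (All; []; _∷_)
open import Data.List.Relation.Unary.Any using (here; there)
open import Data.Nat.Base using (ℕ; zero; suc; _+_)
open import Data.Nat.Properties using (+-identityʳ; +-suc; suc-injective) renaming (_≟_ to _≟ℕ_)
open import Data.Product.Base using (_×_; _,_; proj₁; proj₂; ∃-syntax)
open import Data.Product.Properties using (≡-dec)
open import Data.Sum.Base using (_⊎_; inj₁; inj₂; [_,_])
open import Function.Base using (_∘_; id; const; case_of_)
open import Function.Bundles using (_⇔_; mk⇔)
open import Relation.Binary.Definitions using (DecidableEquality)
open import Relation.Binary.PropositionalEquality using (_≡_; refl; sym; trans; cong; cong₂; subst)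
open import Relation.Nullary.Decidable using (Dec; yes; no; does; map′; dec-true; dec-false)
open import Relation.Nullary.Negation using (¬_; contradiction)
open import Defs

private variable
  G H L : Formula

-- Valuations

record IsModel (v : Name × Name → Bool) : Set where
  field
    model₁ : ∀ {a b} → v (a , b) ≡ true → v (a , a) ≡ true
    model₂ : ∀ {a b c} → v (a , b) ≡ true → v (b , c) ≡ true → v (a , c) ≡ true
    model₃ : ∀ {a b} → v (a , b) ≡ true → v (b , b) ≡ true → v (b , a) ≡ true

open IsModel

Refutable : Formula → Set
Refutable A = ∃[ v ] IsModel v × eval v A ≡ false

eval-⟦⟧ : ∀ {X Y : Set} (v : Y → Bool) (σ : X → Form Y) A →
          eval v (A ⟦ σ ⟧) ≡ eval (eval v ∘ σ) A
eval-⟦⟧ v σ (atom x) = refl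
eval-⟦⟧ v σ (A ∨ B)  = cong₂ _or_ (eval-⟦⟧ v σ A) (eval-⟦⟧ v σ B)
eval-⟦⟧ v σ (∼ A)    = cong not (eval-⟦⟧ v σ A)

true≢false : ∀ {x} → x ≡ true → x ≡ false → ⊥
true≢false refl ()

imp⁺ : ∀ {x y} → (x ≡ true → y ≡ true) → not x or y ≡ true
imp⁺ {false} f = refl
imp⁺ {true}  f = f refl

imp₂⁺ : ∀ {x y z} → (x ≡ true → y ≡ true → z ≡ true) →
        not (not (not x or not y)) or z ≡ true
imp₂⁺ {false}        f = refl
imp₂⁺ {true} {false} f = refl
imp₂⁺ {true} {true}  f = f refl refl

imp⁻ : ∀ {x y} → not x or y ≡ true → x ≡ true → y ≡ true
imp⁻ p refl = p

contrapositive : ∀ {x y} → (y ≡ false → x ≡ false) → x ≡ true → y ≡ true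
contrapositive {y = false} f x≡t = contradiction (f refl) (true≢false x≡t)
contrapositive {y = true}  f x≡t = refl

contrapositive′ : ∀ {x y} → (x ≡ true → y ≡ true) → y ≡ false → x ≡ false
contrapositive′ {x = false} f y≡f = refl
contrapositive′ {x = true}  f y≡f = contradiction y≡f (true≢false (f refl))

⊢H-sound : ∀ {v A} → IsModel v → ⊢H A → eval v A ≡ true
⊢H-sound {v} m (taut P σ t) = trans (eval-⟦⟧ v σ P) (t (eval v ∘ σ))
⊢H-sound m (ax₁ a b)   = imp⁺ (model₁ m)
⊢H-sound m (ax₂ a b c) = imp₂⁺ (model₂ m)
⊢H-sound m (ax₃ a b)   = imp₂⁺ (model₃ m)
⊢H-sound m (mp p q)    = imp⁻ (⊢H-sound m p) (⊢H-sound m q)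

-- Every pair is reached by walking the antidiagonals.
diagonal : ℕ → Name × Name
diagonal zero    = 0 , 0
diagonal (suc n) with diagonal n
... | a , zero  = 0 , suc a
... | a , suc b = suc a , b

-- The walk is traced backwards: `(suc a , b)` comes from `(a , suc b)` on the same antidiagonal,
-- and `(0 , suc b)` from `(b , 0)`, the end of the previous one. The sum `s` is an argument so that
-- the recursion descends lexicographically in `s` and `a`.
diagonal-surjective : ∀ s a b → a + b ≡ s → ∃[ n ] diagonal n ≡ (a , b)
diagonal-surjective s zero zero eq = 0 , refl
diagonal-surjective (suc s) zero (suc b) eq
  with n , e ← diagonal-surjective s b 0 (trans (+-identityʳ b) (suc-injective eq))
  = suc n , next e
  where
  next : diagonal n ≡ (b , 0) → diagonal (suc n) ≡ (0 , suc b)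
  next e rewrite e = refl
diagonal-surjective s (suc a) b eq
  with n , e ← diagonal-surjective s a (suc b) (trans (+-suc a b) eq)
  = suc n , next e
  where
  next : diagonal n ≡ (a , suc b) → diagonal (suc n) ≡ (suc a , b)
  next e rewrite e = refl

code : Name × Name → ℕ
code (a , b) = proj₁ (diagonal-surjective (a + b) a b refl)

diagonal∘code : ∀ x → diagonal (code x) ≡ x
diagonal∘code (a , b) = proj₂ (diagonal-surjective (a + b) a b refl)

-- Axiom schemata have atoms in `ℕ`, so the atoms of `A` are coded as numbers; substituting the
-- decoded atoms gives back `A`.
⊢H-tautology : ∀ A → (∀ v → eval v A ≡ true) → ⊢H A
⊢H-tautology A valid =
  subst ⊢H_ (decode A)
    (taut (A ⟦ atom ∘ code ⟧) (atom ∘ diagonal)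
      (λ v → trans (eval-⟦⟧ v (atom ∘ code) A) (valid (v ∘ code))))
  where
  decode : ∀ A → (A ⟦ atom ∘ code ⟧) ⟦ atom ∘ diagonal ⟧ ≡ A
  decode (atom x) = cong atom (diagonal∘code x)
  decode (A ∨ B)  = cong₂ _∨_ (decode A) (decode B)
  decode (∼ A)    = cong ∼_ (decode A)

⊢H-⊃ : ∀ {A B} → (∀ v → eval v B ≡ false → eval v A ≡ false) → ⊢H A ⊃ B
⊢H-⊃ f = ⊢H-tautology _ (λ v → imp⁺ (contrapositive (f v)))

-- Positive and negative parts

opposite : Sign → Sign
opposite pos = neg
opposite neg = pos

-- A `Part` is a path that grows at its inner end. The list recurses from the root instead, which
-- makes parts decidable and composable. A negative disjunction is never opened.
parts properParts : Sign → Formula → List (Sign × Formula)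
parts s A = (s , A) ∷ properParts s A
properParts s   (atom x) = []
properParts s   (∼ A)    = parts (opposite s) A
properParts pos (A ∨ B)  = parts pos A ++ parts pos B
properParts neg (A ∨ B)  = []

∈-parts⁻ : ∀ {s t B} A → Part s A G → (t , B) ∈ parts s A → Part t B G
∈-parts⁻ A p (here refl) = p
∈-parts⁻ {s = pos} (∼ A) p (there i) = ∈-parts⁻ A (∼⁺ p) i
∈-parts⁻ {s = neg} (∼ A) p (there i) = ∈-parts⁻ A (∼⁻ p) i
∈-parts⁻ {s = pos} (A ∨ B) p (there i) with ∈-++⁻ (parts pos A) i
... | inj₁ j = ∈-parts⁻ A (∨ˡ p) j
... | inj₂ j = ∈-parts⁻ B (∨ʳ p) j

-- Reconciles the two directions: a path extended at its inner end stays in a list computed from the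
-- root.
parts-trans : ∀ {s t B} A → (t , B) ∈ parts s A → parts t B ⊆ parts s A
parts-trans A (here refl) = id
parts-trans (∼ A) (there i) = there ∘ parts-trans A i
parts-trans {s = pos} (A ∨ B) (there i) with ∈-++⁻ (parts pos A) i
... | inj₁ j = there ∘ ∈-++⁺ˡ ∘ parts-trans A j
... | inj₂ j = there ∘ ∈-++⁺ʳ (parts pos A) ∘ parts-trans B j

∈-parts⁺ : ∀ {t B} → Part t B G → (t , B) ∈ parts pos G
∈-parts⁺ root = here refl
∈-parts⁺ {G} (∨ˡ p) = parts-trans G (∈-parts⁺ p) (there (here refl))
∈-parts⁺ {G} (∨ʳ {B = B} p) =
  parts-trans G (∈-parts⁺ p) (there (∈-++⁺ʳ (parts pos B) (here refl)))
∈-parts⁺ {G} (∼⁺ p) = parts-trans G (∈-parts⁺ p) (there (here refl))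
∈-parts⁺ {G} (∼⁻ p) = parts-trans G (∈-parts⁺ p) (there (here refl))

Part-trans : ∀ {A t B} → Part pos A G → Part t B A → Part t B G
Part-trans {A = A} p q = ∈-parts⁻ A p (∈-parts⁺ q)

Part-neg-∨⁻ : ∀ {A B C} → Part neg C (A ∨ B) → Part neg C A ⊎ Part neg C B
Part-neg-∨⁻ {A} {B} p with ∈-parts⁺ p
... | there i with ∈-++⁻ (parts pos A) i
...   | inj₁ j = inj₁ (∈-parts⁻ A root j)
...   | inj₂ j = inj₂ (∈-parts⁻ B root j)

Part-∨⁺ˡ : ∀ {A B t C} → Part t C A → Part t C (A ∨ B)
Part-∨⁺ˡ p = Part-trans (∨ˡ root) p

Part-∨⁺ʳ : ∀ {A B t C} → Part t C B → Part t C (A ∨ B)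
Part-∨⁺ʳ p = Part-trans (∨ʳ root) p

infix 4 _≟ˢ_ _≟_

_≟ˢ_ : DecidableEquality Sign
pos ≟ˢ pos = yes refl
pos ≟ˢ neg = no λ ()
neg ≟ˢ pos = no λ ()
neg ≟ˢ neg = yes refl

_≟_ : DecidableEquality Formula
atom x  ≟ atom y  = map′ (cong atom) (λ { refl → refl }) (≡-dec _≟ℕ_ _≟ℕ_ x y)
atom _  ≟ (_ ∨ _) = no λ ()
atom _  ≟ (∼ _)   = no λ ()
(_ ∨ _) ≟ atom _  = no λ ()
(A ∨ B) ≟ (C ∨ D) with A ≟ C | B ≟ D
... | yes refl | yes refl = yes refl
... | no A≢C   | _        = no λ { refl → A≢C refl }
... | yes _    | no B≢D   = no λ { refl → B≢D refl }
(_ ∨ _) ≟ (∼ _)   = no λ ()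
(∼ _)   ≟ atom _  = no λ ()
(∼ _)   ≟ (_ ∨ _) = no λ ()
(∼ A)   ≟ (∼ B)   = map′ (cong ∼_) (λ { refl → refl }) (A ≟ B)

open import Data.List.Membership.DecPropositional (≡-dec _≟ˢ_ _≟_) using (_∈?_)

part? : ∀ s B A → Dec (Part s B A)
part? s B A = map′ (∈-parts⁻ A root) ∈-parts⁺ ((s , B) ∈? parts pos A)

-- An atom has no proper parts: a longer path would pass through a compound formula equal to it.
⊑-atom : ∀ {s x t B} {p : Part s (atom x) G} {q : Part t B G} →
         p ⊑ q → (t , B) ≡ (s , atom x)
⊑-atom here = refl
⊑-atom (∨ˡ o) with () ← ⊑-atom o
⊑-atom (∨ʳ o) with () ← ⊑-atom o
⊑-atom (∼⁺ o) with () ← ⊑-atom o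
⊑-atom (∼⁻ o) with () ← ⊑-atom o

module _ {v : Name × Name → Bool} (G≡f : eval v G ≡ false) where

  pos-false : ∀ {B} → Part pos B G → eval v B ≡ false
  neg-true  : ∀ {B} → Part neg B G → eval v B ≡ true
  pos-false root   = G≡f
  pos-false (∨ˡ p) = ∨-conicalˡ _ _ (pos-false p)
  pos-false (∨ʳ p) = ∨-conicalʳ _ _ (pos-false p)
  pos-false (∼⁻ p) = not-injective (neg-true p)
  neg-true  (∼⁺ p) = not-injective (pos-false p)

-- The countermodel given by a Hintikka formula

open Hintikka

-- Overlapping occurrences of an atom coincide by `⊑-atom`, so occurrences of opposite sign cannot
-- overlap, and `consistent` applies.
Hintikka-atom : ∀ {x} → Hintikka H → Part pos (atom x) H → ¬ Part neg (atom x) H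
Hintikka-atom h p q = consistent h
  (_ , p , q , (λ o → case ⊑-atom o of λ ()) , (λ o → case ⊑-atom o of λ ()))

module _ {v : Name × Name → Bool} (h : Hintikka H)
         (pos-atoms : ∀ {x} → Part pos (atom x) H → v x ≡ false)
         (neg-atoms : ∀ {x} → Part neg (atom x) H → v x ≡ true) where

  -- Values fixed at the atomic parts spread to all parts, with `∨-closed` handling negative
  -- disjunctions. Any such `v` is allowed, so this yields both the countermodel `val H` and a
  -- propositional implication for `Hintikka⇒⊣H`.
  Hintikka-pos : ∀ B → Part pos B H → eval v B ≡ false
  Hintikka-neg : ∀ B → Part neg B H → eval v B ≡ true
  Hintikka-pos (atom x) p = pos-atoms p
  Hintikka-pos (B ∨ C)  p = cong₂ _or_ (Hintikka-pos B (∨ˡ p)) (Hintikka-pos C (∨ʳ p))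
  Hintikka-pos (∼ B)    p = cong not (Hintikka-neg B (∼⁺ p))
  Hintikka-neg (atom x) p = neg-atoms p
  Hintikka-neg (∼ B)    p = cong not (Hintikka-pos B (∼⁻ p))
  Hintikka-neg (B ∨ C)  p with ∨-closed h p
  ... | inj₁ q rewrite Hintikka-neg B q = refl
  ... | inj₂ q rewrite Hintikka-neg C q = ∨-zeroʳ (eval v B)

val : Formula → Name × Name → Bool
val H x = does (part? neg (atom x) H)

val⁺ : ∀ {x} → Part neg (atom x) H → val H x ≡ true
val⁺ = dec-true (part? _ _ _)

val⁻ : ∀ {x} → val H x ≡ true → Part neg (atom x) H
val⁻ = does⁻ (part? _ _ _)
  where
  does⁻ : ∀ {P : Set} (P? : Dec P) → does P? ≡ true → P
  does⁻ (yes p) _ = p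

val-isModel : Hintikka H → IsModel (val H)
val-isModel h .model₁ p   = val⁺ (ε₁-closed h (val⁻ p))
val-isModel h .model₂ p q = val⁺ (ε₂-closed h (val⁻ p) (val⁻ q))
val-isModel h .model₃ p q = val⁺ (ε₃-closed h (val⁻ p) (val⁻ q))

val-pos : ∀ {x} → Hintikka H → Part pos (atom x) H → val H x ≡ false
val-pos h p = dec-false (part? _ _ _) (Hintikka-atom h p)

val-false : Hintikka H → eval (val H) H ≡ false
val-false h = Hintikka-pos h (val-pos h) val⁺ _ root

⊣H⇒refutable : ∀ {a₀ A} → a₀ ⊣H A → Refutable A
⊣H⇒refutable rej-atom = const false , record { model₁ = id ; model₂ = λ () ; model₃ = λ () } , refl
⊣H⇒refutable rej-∼atom =
  const true , record { model₁ = id ; model₂ = λ _ → id ; model₃ = λ _ → id } , refl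
⊣H⇒refutable (rej-mp A⊃B r) =
  let v , m , B≡f = ⊣H⇒refutable r in
  v , m , contrapositive′ (imp⁻ (⊢H-sound m A⊃B)) B≡f
⊣H⇒refutable (rej-subst f {B} r) =
  let v , m , B≡f = ⊣H⇒refutable r in
  -- The countermodel of the renamed formula is pulled back along `f`.
  (λ (a , b) → v (f a , f b)) ,
  record { model₁ = model₁ m ; model₂ = model₂ m ; model₃ = model₃ m } ,
  trans (sym (eval-⟦⟧ v _ B)) B≡f
⊣H⇒refutable (rej-∨ {A} h _ _ ab∉A) =
  -- An arbitrary countermodel of `A` might make `ε a b` true; `val A` is false at every atom that
  -- is not a negative part.
  val A , val-isModel h , cong₂ _or_ (val-false h) (dec-false (part? _ _ _) ab∉A)

-- Rejecting Hintikka formulas in HAR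

signedAtoms : Sign → List (Sign × Formula) → List (Name × Name)
signedAtoms s [] = []
signedAtoms s ((t , atom x) ∷ ps) with s ≟ˢ t
... | yes _ = x ∷ signedAtoms s ps
... | no  _ = signedAtoms s ps
signedAtoms s ((t , _ ∨ _) ∷ ps) = signedAtoms s ps
signedAtoms s ((t , ∼ _)   ∷ ps) = signedAtoms s ps

∈-signedAtoms⁺ : ∀ {s x} ps → (s , atom x) ∈ ps → x ∈ signedAtoms s ps
∈-signedAtoms⁺ {s} ((t , atom x) ∷ ps) i with s ≟ˢ t | i
... | yes _  | here refl = here refl
... | yes _  | there j   = there (∈-signedAtoms⁺ ps j)
... | no s≢t | here refl = contradiction refl s≢t
... | no _   | there j   = ∈-signedAtoms⁺ ps j
∈-signedAtoms⁺ ((t , _ ∨ _) ∷ ps) (there i) = ∈-signedAtoms⁺ ps i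
∈-signedAtoms⁺ ((t , ∼ _)   ∷ ps) (there i) = ∈-signedAtoms⁺ ps i

∈-signedAtoms⁻ : ∀ {s x} ps → x ∈ signedAtoms s ps → (s , atom x) ∈ ps
∈-signedAtoms⁻ {s} ((t , atom x) ∷ ps) i with s ≟ˢ t | i
... | yes refl | here refl = here refl
... | yes refl | there j   = there (∈-signedAtoms⁻ ps j)
... | no _     | j         = there (∈-signedAtoms⁻ ps j)
∈-signedAtoms⁻ ((t , _ ∨ _) ∷ ps) i = there (∈-signedAtoms⁻ ps i)
∈-signedAtoms⁻ ((t , ∼ _)   ∷ ps) i = there (∈-signedAtoms⁻ ps i)

infixl 6 _∨⋆_

_∨⋆_ : Formula → List (Name × Name) → Formula
_∨⋆_ = foldl (λ E x → E ∨ atom x)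

-- A finite diagram of `v`, in negated form. By `falsified` and `neg-complete`, the negative atoms
-- of `E` are exactly the atoms true in `v`.
record RejectedDiagram (a₀ : Name) (v : Name × Name → Bool) (E : Formula) : Set where
  field
    literals     : LiteralDisjunction E
    rejected     : a₀ ⊣H E
    falsified    : eval v E ≡ false
    neg-complete : ∀ {x} → v x ≡ true → Part neg (atom x) E

open RejectedDiagram

LiteralDisjunction-neg : ∀ {E B} → LiteralDisjunction E → Part neg B E → ∃[ x ] B ≡ atom x
LiteralDisjunction-neg atom p with ∈-parts⁺ p
... | here ()
... | there ()
LiteralDisjunction-neg ∼atom p with ∈-parts⁺ p
... | there (here refl) = _ , refl
LiteralDisjunction-neg (l ∨ m) p =
  [ LiteralDisjunction-neg l , LiteralDisjunction-neg m ] (Part-neg-∨⁻ p)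

module _ {a₀ : Name} {v : Name × Name → Bool} (m : IsModel v) where

  -- The model conditions on `v` turn into the ε-closure conditions, since negative atoms and true
  -- atoms agree; in a disjunction of literals no negative part is a disjunction.
  diagram-Hintikka : ∀ {E} → RejectedDiagram a₀ v E → Hintikka E
  diagram-Hintikka d = record
    { consistent = λ (_ , p , q , _) → true≢false (neg-true (falsified d) q) (pos-false (falsified d) p)
    ; ∨-closed   = λ p → case LiteralDisjunction-neg (literals d) p of λ ()
    ; ε₁-closed  = λ p → neg-complete d (model₁ m (neg⁻ p))
    ; ε₂-closed  = λ p q → neg-complete d (model₂ m (neg⁻ p) (neg⁻ q))
    ; ε₃-closed  = λ p q → neg-complete d (model₃ m (neg⁻ p) (neg⁻ q))
    }
    where
    neg⁻ : ∀ {x} → Part neg (atom x) _ → v x ≡ true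
    neg⁻ = neg-true (falsified d)

  -- Every negative part is true in `v`, so an atom false in `v` is not one and the last rule of HAR
  -- adds it. The enlarged diagram is again Hintikka, so the step repeats.
  diagram-extend : ∀ {E} → RejectedDiagram a₀ v E → ∀ {xs} → All (λ x → v x ≡ false) xs →
                   RejectedDiagram a₀ v (E ∨⋆ xs)
  diagram-extend d [] = d
  diagram-extend d (x≡f ∷ xs≡f) = diagram-extend d′ xs≡f
    where
    d′ : RejectedDiagram a₀ v _
    d′ = record
      { literals     = literals d ∨ atom
      ; rejected     = rej-∨ (diagram-Hintikka d) (literals d) (rejected d)
                         (λ p → true≢false (neg-true (falsified d) p) x≡f)
      ; falsified    = cong₂ _or_ (falsified d) x≡f
      ; neg-complete = Part-∨⁺ˡ ∘ neg-complete d
      }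

∨⋆-false : ∀ {u} E xs → eval u (E ∨⋆ xs) ≡ false →
           eval u E ≡ false × All (λ x → u x ≡ false) xs
∨⋆-false E [] eq = eq , []
∨⋆-false E (x ∷ xs) eq =
  let e , es = ∨⋆-false (E ∨ atom x) xs eq in
  ∨-conicalˡ _ _ e , ∨-conicalʳ _ _ e ∷ es

-- The disjunction of no literals is replaced by a rejected atom.
negatedAtoms : Name → List (Name × Name) → Formula
negatedAtoms a₀ []           = ε a₀ a₀
negatedAtoms a₀ (x ∷ [])     = ∼ atom x
negatedAtoms a₀ (x ∷ y ∷ xs) = ∼ atom x ∨ negatedAtoms a₀ (y ∷ xs)

module _ (a₀ : Name) where

  negatedAtoms-literals : ∀ xs → LiteralDisjunction (negatedAtoms a₀ xs)
  negatedAtoms-literals []           = atom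
  negatedAtoms-literals (x ∷ [])     = ∼atom
  negatedAtoms-literals (x ∷ y ∷ xs) = ∼atom ∨ negatedAtoms-literals (y ∷ xs)

  negatedAtoms-false⁻ : ∀ {u} xs → eval u (negatedAtoms a₀ xs) ≡ false → All (λ x → u x ≡ true) xs
  negatedAtoms-false⁻ []           eq = []
  negatedAtoms-false⁻ (x ∷ [])     eq = not-injective eq ∷ []
  negatedAtoms-false⁻ (x ∷ y ∷ xs) eq =
    not-injective (∨-conicalˡ _ _ eq) ∷ negatedAtoms-false⁻ (y ∷ xs) (∨-conicalʳ _ _ eq)

  negatedAtoms-false⁺ : ∀ {v x} xs → All (λ x → v x ≡ true) (x ∷ xs) →
                        eval v (negatedAtoms a₀ (x ∷ xs)) ≡ false
  negatedAtoms-false⁺ []       (x≡t ∷ [])   = cong not x≡t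
  negatedAtoms-false⁺ (_ ∷ xs) (x≡t ∷ xs≡t) = cong₂ _or_ (cong not x≡t) (negatedAtoms-false⁺ xs xs≡t)

  ∈-negatedAtoms : ∀ {x} xs → x ∈ xs → Part neg (atom x) (negatedAtoms a₀ xs)
  ∈-negatedAtoms (x ∷ [])     (here refl) = ∼⁺ root
  ∈-negatedAtoms (x ∷ y ∷ xs) (here refl) = ∼⁺ (∨ˡ root)
  ∈-negatedAtoms (x ∷ y ∷ xs) (there i)   = Part-∨⁺ʳ (∈-negatedAtoms (y ∷ xs) i)

  -- Identifying all names with a₀ turns a disjunction of negated atoms into copies of ∼ ε a₀ a₀.
  negatedAtoms-rejected : ∀ xs → a₀ ⊣H negatedAtoms a₀ xs
  negatedAtoms-rejected []       = rej-atom
  negatedAtoms-rejected (x ∷ xs) =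
    rej-subst (const a₀) (rej-mp (⊢H-⊃ (λ v → trans (collapse v x xs))) rej-∼atom)
    where
    collapse : ∀ v x xs → eval v (rename (const a₀) (negatedAtoms a₀ (x ∷ xs))) ≡ not (v (a₀ , a₀))
    collapse v x []       = refl
    collapse v x (y ∷ xs) = trans (cong (not (v (a₀ , a₀)) or_) (collapse v y xs)) (∨-idem _)

  negatedAtoms-diagram : ∀ {v} xs → All (λ x → v x ≡ true) xs → (∀ {x} → v x ≡ true → x ∈ xs) →
                         RejectedDiagram a₀ v (negatedAtoms a₀ xs)
  negatedAtoms-diagram {v} xs xs≡t xs-complete = record
    { literals     = negatedAtoms-literals xs
    ; rejected     = negatedAtoms-rejected xs
    ; falsified    = false-at xs xs≡t xs-complete
    ; neg-complete = ∈-negatedAtoms xs ∘ xs-complete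
    }
    where
    false-at : ∀ xs → All (λ x → v x ≡ true) xs → (∀ {x} → v x ≡ true → x ∈ xs) →
               eval v (negatedAtoms a₀ xs) ≡ false
    -- With no true atoms, `v` is false everywhere, hence at the substitute atom `ε a₀ a₀`.
    false-at []       _    complete = ¬-not (λ e → case complete e of λ ())
    false-at (x ∷ xs) xs≡t _        = negatedAtoms-false⁺ xs xs≡t

  Hintikka⇒⊣H : Hintikka H → a₀ ⊣H H
  Hintikka⇒⊣H {H} h = rej-mp (⊢H-⊃ H⊃D) (rejected diagram)
    where
    atoms : Sign → List (Name × Name)
    atoms s = signedAtoms s (parts pos H)

    ∈-atoms⁺ : ∀ {s x} → Part s (atom x) H → x ∈ atoms s
    ∈-atoms⁺ = ∈-signedAtoms⁺ (parts pos H) ∘ ∈-parts⁺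

    ∈-atoms⁻ : ∀ {s x} → x ∈ atoms s → Part s (atom x) H
    ∈-atoms⁻ = ∈-parts⁻ H root ∘ ∈-signedAtoms⁻ (parts pos H)

    D : Formula
    D = negatedAtoms a₀ (atoms neg) ∨⋆ atoms pos

    diagram : RejectedDiagram a₀ (val H) D
    diagram = diagram-extend (val-isModel h)
      (negatedAtoms-diagram (atoms neg) (All.tabulate (val⁺ ∘ ∈-atoms⁻)) (∈-atoms⁺ ∘ val⁻))
      (All.tabulate (val-pos h ∘ ∈-atoms⁻))

    -- Falsifying `D` gives each atomic part of `H` the value its sign requires, for any Boolean
    -- `v`; hence `H ⊃ D` is a tautology.
    H⊃D : ∀ v → eval v D ≡ false → eval v H ≡ false
    H⊃D v D≡f =
      let ns≡f , ps≡f = ∨⋆-false (negatedAtoms a₀ (atoms neg)) (atoms pos) D≡f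
          ns≡t        = negatedAtoms-false⁻ (atoms neg) ns≡f
      in Hintikka-pos h (All.lookup ps≡f ∘ ∈-atoms⁺) (All.lookup ns≡t ∘ ∈-atoms⁺) H root

-- From the end of a branch back to its root

↦-false : ∀ {u G Bs B} → G ↦ Bs → B ∈ Bs → eval u B ≡ false → eval u G ≡ false
↦-false (∨₋ _)      (here refl)         = ∨-conicalˡ _ _
↦-false (∨₋ _)      (there (here refl)) = ∨-conicalˡ _ _
↦-false (ε₁ _)      (here refl)         = ∨-conicalˡ _ _
↦-false (ε₂ _ _ _)  (here refl)         = ∨-conicalˡ _ _
↦-false (ε₃b _ _ _) (here refl)         = ∨-conicalˡ _ _

-- Every rule only appends a disjunct, so the root of a branch propositionally implies its last
-- formula.
branch-false : ∀ {u A} {t : Tableau A} → BranchTo t L → eval u L ≡ false → eval u A ≡ false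
branch-false stop               = id
branch-false (down {r = r} i b) = ↦-false r i ∘ branch-false b

⊣T⇒⊣H : ∀ a₀ {A} → ⊣T A → a₀ ⊣H A
⊣T⇒⊣H a₀ (_ , _ , b , h) = rej-mp (⊢H-⊃ (λ v → branch-false b)) (Hintikka⇒⊣H a₀ h)

-- Saturating a tableau branch along a countermodel

-- One good branch is enough, so the sibling nodes stay undeveloped leaves.
graft : ∀ {Bs B} → B ∈ Bs → Tableau B → All Tableau Bs
graft (here refl) t = t ∷ All.tabulate (const leaf)
graft (there i)   t = leaf ∷ graft i t

graft-branch : ∀ {Bs B} (i : B ∈ Bs) {t : Tableau B} → BranchTo t L →
               BranchTo (All.lookup (graft i t) i) L
graft-branch (here refl) b = b
graft-branch (there i)   b = graft-branch i b

⊣T-↦ : ∀ {Bs B} → G ↦ Bs → B ∈ Bs → ⊣T B → ⊣T G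
⊣T-↦ r i (t , H , b , h) = node r (graft i t) , H , down i (graft-branch i b) , h

-- A finite bound on the negative parts of a tableau

subformulas : Formula → List Formula
subformulas A@(atom _) = A ∷ []
subformulas A@(B ∨ C)  = A ∷ subformulas B ++ subformulas C
subformulas A@(∼ B)    = A ∷ subformulas B

self∈subformulas : ∀ A → A ∈ subformulas A
self∈subformulas (atom _) = here refl
self∈subformulas (_ ∨ _)  = here refl
self∈subformulas (∼ _)    = here refl

subformulas-trans : ∀ {B} A → B ∈ subformulas A → subformulas B ⊆ subformulas A
subformulas-trans (atom _) (here refl) = id
subformulas-trans (A ∨ C)  (here refl) = id
subformulas-trans (∼ A)    (here refl) = id
subformulas-trans (A ∨ C)  (there i) with ∈-++⁻ (subformulas A) i
... | inj₁ j = there ∘ ∈-++⁺ˡ ∘ subformulas-trans A j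
... | inj₂ j = there ∘ ∈-++⁺ʳ (subformulas A) ∘ subformulas-trans C j
subformulas-trans (∼ A)    (there i) = there ∘ subformulas-trans A i

∈-parts⇒∈-subformulas : ∀ {s t B} A → (t , B) ∈ parts s A → B ∈ subformulas A
∈-parts⇒∈-subformulas A (here refl) = self∈subformulas A
∈-parts⇒∈-subformulas (∼ A) (there i) = there (∈-parts⇒∈-subformulas A i)
∈-parts⇒∈-subformulas {s = pos} (A ∨ B) (there i) with ∈-++⁻ (parts pos A) i
... | inj₁ j = there (∈-++⁺ˡ (∈-parts⇒∈-subformulas A j))
... | inj₂ j = there (∈-++⁺ʳ (subformulas A) (∈-parts⇒∈-subformulas B j))

names : Formula → List Name
names (ε a b) = a ∷ b ∷ []
names (A ∨ B) = names A ++ names B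
names (∼ A)   = names A

subformulas-names : ∀ {B} A → B ∈ subformulas A → names B ⊆ names A
subformulas-names (atom _) (here refl) = id
subformulas-names (A ∨ C)  (here refl) = id
subformulas-names (∼ A)    (here refl) = id
subformulas-names (A ∨ C)  (there i) with ∈-++⁻ (subformulas A) i
... | inj₁ j = ∈-++⁺ˡ ∘ subformulas-names A j
... | inj₂ j = ∈-++⁺ʳ (names A) ∘ subformulas-names C j
subformulas-names (∼ A)    (there i) = subformulas-names A i

-- Contains every formula that can occur as a negative part in a tableau for A.
candidates : Formula → List Formula
candidates A = subformulas A ++ cartesianProductWith ε (names A) (names A)

module _ (A : Formula) where

  ∈-candidates-ε : ∀ {a b} → a ∈ names A → b ∈ names A → ε a b ∈ candidates A
  ∈-candidates-ε i j = ∈-++⁺ʳ (subformulas A) (∈-cartesianProductWith⁺ ε i j)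

  candidates-subformulas : ∀ {B} → B ∈ candidates A → subformulas B ⊆ candidates A
  candidates-subformulas i with ∈-++⁻ (subformulas A) i
  ... | inj₁ j = ∈-++⁺ˡ ∘ subformulas-trans A j
  ... | inj₂ j with _ , _ , _ , _ , refl ← ∈-cartesianProductWith⁻ ε (names A) (names A) j
    = λ { (here refl) → i }

  candidates-names : ∀ {B} → B ∈ candidates A → names B ⊆ names A
  candidates-names i with ∈-++⁻ (subformulas A) i
  ... | inj₁ j = subformulas-names A j
  ... | inj₂ j with _ , _ , a∈ , b∈ , refl ← ∈-cartesianProductWith⁻ ε (names A) (names A) j
    = λ { (here refl) → a∈ ; (there (here refl)) → b∈ }

-- Rule applications guided by a countermodel

module _ {v : Name × Name → Bool} (m : IsModel v) where

  -- Of the two disjuncts of a true negative part, a true one is chosen.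
  conclusions : Formula → Formula → List Formula
  conclusions (B ∨ C) _ = (if eval v B then B else C) ∷ []
  conclusions (ε a b) (ε c d) with b ≟ℕ c | c ≟ℕ d
  ... | no  _ | _     = ε a a ∷ []
  ... | yes _ | no  _ = ε a a ∷ ε a d ∷ []
  ... | yes _ | yes _ = ε a a ∷ ε a d ∷ ε b a ∷ []
  conclusions _ _ = []

  -- All rules are cast with two premises, so that one saturation condition covers them; for a
  -- one-premise rule, `P` itself can serve as `Q`. This relation is for reasoning by cases, the
  -- list `conclusions` for searching.
  data Conclusion : Formula → Formula → Formula → Set where
    left  : ∀ {B C Q} → eval v B ≡ true → Conclusion (B ∨ C) Q B
    right : ∀ {B C Q} → eval v B ≡ false → Conclusion (B ∨ C) Q C
    by-ε₁ : ∀ {a b c d} → Conclusion (ε a b) (ε c d) (ε a a)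
    by-ε₂ : ∀ {a b c} → Conclusion (ε a b) (ε b c) (ε a c)
    by-ε₃ : ∀ {a b} → Conclusion (ε a b) (ε b b) (ε b a)

  ∈-conclusions⁻ : ∀ P Q {X} → X ∈ conclusions P Q → Conclusion P Q X
  ∈-conclusions⁻ (B ∨ C) _ i with eval v B in eq | i
  ... | true  | here refl = left eq
  ... | false | here refl = right eq
  ∈-conclusions⁻ (ε a b) (ε c d) i with b ≟ℕ c | c ≟ℕ d | i
  ... | no  _    | _        | here refl                 = by-ε₁
  ... | yes _    | no  _    | here refl                 = by-ε₁
  ... | yes refl | no  _    | there (here refl)         = by-ε₂
  ... | yes _    | yes _    | here refl                 = by-ε₁
  ... | yes refl | yes _    | there (here refl)         = by-ε₂
  ... | yes refl | yes refl | there (there (here refl)) = by-ε₃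

  ∈-conclusions⁺ : ∀ {P Q X} → Conclusion P Q X → X ∈ conclusions P Q
  ∈-conclusions⁺ (left eq)  rewrite eq = here refl
  ∈-conclusions⁺ (right eq) rewrite eq = here refl
  ∈-conclusions⁺ (by-ε₁ {b = b} {c} {d}) with b ≟ℕ c | c ≟ℕ d
  ... | no  _ | _     = here refl
  ... | yes _ | no  _ = here refl
  ... | yes _ | yes _ = here refl
  ∈-conclusions⁺ (by-ε₂ {b = b} {c}) with b ≟ℕ b | b ≟ℕ c
  ... | no b≢b | _     = contradiction refl b≢b
  ... | yes _  | no  _ = there (here refl)
  ... | yes _  | yes _ = there (here refl)
  ∈-conclusions⁺ (by-ε₃ {b = b}) with b ≟ℕ b
  ... | no b≢b = contradiction refl b≢b
  ... | yes _  = there (there (here refl))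

  conclusion-true : ∀ {P Q X} → Conclusion P Q X → eval v P ≡ true → eval v Q ≡ true → eval v X ≡ true
  conclusion-true (left B≡t)  p q = B≡t
  conclusion-true (right B≡f) p q = subst (λ x → x or _ ≡ true) B≡f p
  conclusion-true by-ε₁       p q = model₁ m p
  conclusion-true by-ε₂       p q = model₂ m p q
  conclusion-true by-ε₃       p q = model₃ m p q

  -- Overlapping premises of ε₂ and ε₃b coincide, and then the conclusion is one of them.
  conclusion-rule : ∀ {P Q X} → Conclusion P Q X → Part neg P G → Part neg Q G → ¬ Part neg X G →
                    ∃[ Bs ] (G ↦ Bs) × (G ∨ ∼ X) ∈ Bs
  conclusion-rule (left _)  p q _ = _ , ∨₋ p , here refl
  conclusion-rule (right _) p q _ = _ , ∨₋ p , there (here refl)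
  conclusion-rule by-ε₁     p q _ = _ , ε₁ p , here refl
  conclusion-rule by-ε₂     p q ¬x = _ , ε₂ p q (apart , apart′) , here refl
    where
    apart : ¬ (p ⊑ q)
    apart o with refl ← ⊑-atom o = ¬x p
    apart′ : ¬ (q ⊑ p)
    apart′ o with refl ← ⊑-atom o = ¬x p
  conclusion-rule by-ε₃     p q ¬x = _ , ε₃b p q (apart , apart′) , here refl
    where
    apart : ¬ (p ⊑ q)
    apart o with refl ← ⊑-atom o = ¬x p
    apart′ : ¬ (q ⊑ p)
    apart′ o with refl ← ⊑-atom o = ¬x p

  Saturated Unsaturated : Formula → Set
  Saturated G   = ∀ {P Q X} → Conclusion P Q X → Part neg P G → Part neg Q G → Part neg X G
  Unsaturated G = ∃[ P ] ∃[ Q ] ∃[ X ] Conclusion P Q X × Part neg P G × Part neg Q G × ¬ Part neg X G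

  -- Consistency comes from `v` falsifying `G`, the closure conditions from saturation; for a
  -- disjunction, the disjunct selected by `v` is the one present.
  saturated⇒Hintikka : eval v G ≡ false → Saturated G → Hintikka G
  saturated⇒Hintikka {G} G≡f sat = record
    { consistent = λ (_ , p , q , _) → true≢false (neg-true G≡f q) (pos-false G≡f p)
    ; ∨-closed   = closed
    ; ε₁-closed  = λ p → sat by-ε₁ p p
    ; ε₂-closed  = sat by-ε₂
    ; ε₃-closed  = sat by-ε₃
    }
    where
    closed : ∀ {B C} → Part neg (B ∨ C) G → Part neg B G ⊎ Part neg C G
    closed {B} p with eval v B in eq
    ... | true  = inj₁ (sat (left eq) p p)
    ... | false = inj₂ (sat (right eq) p p)

  module _ (A : Formula) where

    NegCandidates : Formula → Set
    NegCandidates G = ∀ {B} → Part neg B G → B ∈ candidates A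

    conclusion-candidate : ∀ {P Q X} → Conclusion P Q X →
      P ∈ candidates A → Q ∈ candidates A → X ∈ candidates A
    conclusion-candidate (left {B} _) i j =
      candidates-subformulas A i (there (∈-++⁺ˡ (self∈subformulas B)))
    conclusion-candidate (right {B} {C} _) i j =
      candidates-subformulas A i (there (∈-++⁺ʳ (subformulas B) (self∈subformulas C)))
    conclusion-candidate by-ε₁ i j =
      ∈-candidates-ε A (candidates-names A i (here refl)) (candidates-names A i (here refl))
    conclusion-candidate by-ε₂ i j =
      ∈-candidates-ε A (candidates-names A i (here refl)) (candidates-names A j (there (here refl)))
    conclusion-candidate by-ε₃ i j =
      ∈-candidates-ε A (candidates-names A j (here refl)) (candidates-names A i (here refl))

    -- Premises lie in the finite list of candidates and each pair has finitely many conclusions, so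
    -- a finite search either verifies saturation or exhibits a violation.
    saturated? : NegCandidates G → Saturated G ⊎ Unsaturated G
    saturated? {G} cand
      with All.decide (λ P → All.decide (λ Q →
             All.decide (check P Q) (conclusions P Q)) (candidates A)) (candidates A)
      where
      check : ∀ P Q X → (Part neg P G → Part neg Q G → Part neg X G)
                        ⊎ (Part neg P G × Part neg Q G × ¬ Part neg X G)
      check P Q X with part? neg P G | part? neg Q G | part? neg X G
      ... | no ¬p | _     | _     = inj₁ (λ p → contradiction p ¬p)
      ... | yes _ | no ¬q | _     = inj₁ (λ _ q → contradiction q ¬q)
      ... | yes _ | yes _ | yes x = inj₁ (λ _ _ → x)
      ... | yes p | yes q | no ¬x = inj₂ (p , q , ¬x)
    ... | inj₁ closed = inj₁ λ c p q →
      All.lookup (All.lookup (All.lookup closed (cand p)) (cand q)) (∈-conclusions⁺ c) p q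
    ... | inj₂ violated
      with P , _ , violatedᴾ ← find violated
      with Q , _ , violatedᴾᑫ ← find violatedᴾ
      with X , i , p , q , ¬x ← find violatedᴾᑫ
      = inj₂ (P , Q , X , ∈-conclusions⁻ P Q i , p , q , ¬x)

    NegCandidates-extend : ∀ {X} → NegCandidates G → X ∈ candidates A → NegCandidates (G ∨ ∼ X)
    NegCandidates-extend {X = X} cand i p with Part-neg-∨⁻ p
    ... | inj₁ q = cand q
    ... | inj₂ q with ∈-parts⁺ q
    ...   | there j = candidates-subformulas A i (∈-parts⇒∈-subformulas X j)

    -- Rs lists the candidates that may still be added as negative parts.
    saturate : ∀ n Rs G → length Rs ≡ n → NegCandidates G →
               (∀ {X} → X ∈ candidates A → ¬ Part neg X G → X ∈ Rs) →
               eval v G ≡ false → ⊣T G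
    saturate n Rs G len cand rest G≡f with saturated? cand
    ... | inj₁ sat = leaf , G , stop , saturated⇒Hintikka G≡f sat
    ... | inj₂ (P , Q , X , c , p , q , ¬x)
      with X∈ ← conclusion-candidate c (cand p) (cand q)
      with ys , zs , refl ← ∈-∃++ (rest X∈ ¬x)
      -- `X` leaves `Rs`, whose length therefore drops by one; this rules out `n` being zero.
      with n | trans (sym (length-++-sucʳ ys X zs)) len
    ...   | suc k | len′ =
      let _ , r , i = conclusion-rule c p q ¬x in
      ⊣T-↦ r i (saturate k (ys ++ zs) (G ∨ ∼ X) (suc-injective len′)
        (NegCandidates-extend cand X∈) rest′
        -- The new disjunct is false because `X`, drawn from premises true in `v`, is true.
        (cong₂ _or_ G≡f (cong not (conclusion-true c (neg-true G≡f p) (neg-true G≡f q)))))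
      where
      rest′ : ∀ {Y} → Y ∈ candidates A → ¬ Part neg Y (G ∨ ∼ X) → Y ∈ ys ++ zs
      rest′ Y∈ ¬y with ∈-++⁻ ys (rest Y∈ (¬y ∘ Part-∨⁺ˡ))
      ... | inj₁ j           = ∈-++⁺ˡ j
      -- `X` itself has just become a negative part, so it is no longer awaited.
      ... | inj₂ (here refl) = contradiction (∼⁺ (∨ʳ root)) ¬y
      ... | inj₂ (there j)   = ∈-++⁺ʳ ys j

-- Closing the cycle of implications

refutable⇒⊣T : ∀ {A} → Refutable A → ⊣T A
refutable⇒⊣T {A} (v , m , A≡f) =
  -- At the root all candidates are still available, and every negative part of `A` is a subformula.
  saturate m A _ (candidates A) A refl
    (∈-++⁺ˡ ∘ ∈-parts⇒∈-subformulas A ∘ ∈-parts⁺) (λ i _ → i) A≡f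

theorem8p2 : (a₀ : Name) (A : Formula) → (a₀ ⊣H A) ⇔ (⊣T A)
theorem8p2 a₀ A = mk⇔ (refutable⇒⊣T ∘ ⊣H⇒refutable) (⊣T⇒⊣H a₀)
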